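{- Let $G$ be a super edge-magic graph of size $|E(G)| = 2|V(G)|-3$ and girth $g(G)=3$. Then $|\sigma_G| = 1$, where $\sigma_G$ is the super edge-magic set of $G$.
   Context: Graphs are finite and simple. The notation $[a,b]$ denotes the set of integers $x$ with $a\le x\le b$. An edge-magic labeling of a graph $G$ is a bijection $f:V(G)\cup E(G)\to[1,|V(G)|+|E(G)|]$ such that $f(u)+f(v)+f(uv)$ equals a constant (the valence $\mathrm{val}(f)$ of $f$) for every $uv\in E(G)$. It is super edge-magic if moreover $f(V(G))=[1,|V(G)|]$, and $G$ is super edge-magic if it admits a super edge-magic labeling. For a graph $G$ of order $p$ and size $q$ (with $q\geq 1$), let $$S_G=\left\{\frac{\sum_{u\in V(G)}\deg(u)g(u)+\sum_{i=p+1}^{p+q} i}{q} : g:V(G)\to[1,p]\text{ bijective}\right\}.$$ If $\lceil\min S_G\rceil\le\lfloor\max S_G\rfloor$, the super edge-magic interval of $G$ is $I_G=[\lceil\min S_G\rceil,\lfloor\max S_G\rfloor]$. The super edge-magic set of $G$ is $$\sigma_G=\{k\in I_G : \text{there exists a super edge-magic labeling of } G\text{ with valence } k\}.$$ The girth of a graph is the length of its shortest cycle. -}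

module Defs where

open import Data.Fin.Base as Fin using (Fin; zero; suc; fromℕ; inject₁; toℕ)
import Data.Fin.Properties as Fin
open import Data.Integer.Base as ℤ using (ℤ; +_)
open import Data.Nat.Base using (ℕ; suc; _+_; _*_; _≤_; NonZero)
open import Data.Nat.Properties using (+-0-commutativeMonoid)
open import Data.Product.Base using (Σ-syntax; ∃; ∃-syntax; _×_; _,_; proj₁; proj₂)
open import Data.Rational.Base as ℚ using (ℚ; _/_; floor; ceiling)
open import Data.Sum.Base using (_⊎_; inj₁; inj₂)
open import Data.Vec.Base using (allFin; count)
open import Function.Bundles using (_⤖_; _⇔_; module Bijection)
open import Function.Definitions using (Injective)
open import Level using (0ℓ)
open import Relation.Binary.PropositionalEquality.Core using (_≡_)
open import Relation.Nullary.Decidable using (Dec; _⊎-dec_)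
open import Relation.Unary using (Pred)

open import Algebra.Properties.CommutativeMonoid.Sum +-0-commutativeMonoid
  using (sum)

-- A finite simple graph of order p and size q, with vertex set Fin p and
-- edge set Fin q.  An unordered pair of distinct vertices is represented by
-- the corresponding increasing pair, so there are no loops; injectivity of
-- ends excludes multiple edges.
record Graph (p q : ℕ) : Set where
  field
    ends           : Fin q → Fin p × Fin p
    ends-ordered   : ∀ e → proj₁ (ends e) Fin.< proj₂ (ends e)
    ends-injective : Injective _≡_ _≡_ ends

  src tgt : Fin q → Fin p
  src e = proj₁ (ends e)
  tgt e = proj₂ (ends e)

  Adjacent : Fin p → Fin p → Set
  Adjacent u v = ∃[ e ] (ends e ≡ (u , v) ⊎ ends e ≡ (v , u))

  Incident : Fin p → Fin q → Set
  Incident u e = src e ≡ u ⊎ tgt e ≡ u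

  incident? : ∀ u e → Dec (Incident u e)
  incident? u e = (src e Fin.≟ u) ⊎-dec (tgt e Fin.≟ u)

  deg : Fin p → ℕ
  deg u = count (incident? u) (allFin q)

Interval : ℕ → ℕ → Set
Interval a b = Σ[ x ∈ ℕ ] (a ≤ x × x ≤ b)

HasCardinality : Pred ℤ 0ℓ → ℕ → Set
HasCardinality P n =
  Σ[ e ∈ (Fin n → ℤ) ] (Injective _≡_ _≡_ e × (∀ k → P k ⇔ (∃[ i ] e i ≡ k)))

IsMin IsMax : Pred ℚ 0ℓ → ℚ → Set
IsMin S m = S m × (∀ s → S s → m ℚ.≤ s)
IsMax S M = S M × (∀ s → S s → s ℚ.≤ M)

module _ {p q : ℕ} (G : Graph p q) where
  open Graph G

  -- Cycle n is inhabited when G has a cycle of length n; the vertices of a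
  -- cycle are distinct and there are at least three of them.
  data Cycle : ℕ → Set where
    cycle : ∀ {m} (c : Fin (3 + m) → Fin p) →
            Injective _≡_ _≡_ c →
            (∀ (i : Fin (2 + m)) → Adjacent (c (inject₁ i)) (c (suc i))) →
            Adjacent (c (fromℕ (2 + m))) (c zero) →
            Cycle (3 + m)

  -- A relation rather than a function, since an acyclic graph has no shortest
  -- cycle.
  HasGirth : ℕ → Set
  HasGirth n = Cycle n × (∀ m → Cycle m → n ≤ m)

  Labeling : Set
  Labeling = (Fin p ⊎ Fin q) ⤖ Interval 1 (p + q)

  module _ (f : Labeling) where
    vertexLabel : Fin p → ℕ
    vertexLabel u = proj₁ (Bijection.to f (inj₁ u))

    edgeLabel : Fin q → ℕ
    edgeLabel e = proj₁ (Bijection.to f (inj₂ e))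

    IsEdgeMagic : ℕ → Set
    IsEdgeMagic k =
      ∀ e → vertexLabel (src e) + vertexLabel (tgt e) + edgeLabel e ≡ k

    -- The second component says that the set of vertex labels is [1,p].
    IsSuperEdgeMagicLabeling : ℕ → Set
    IsSuperEdgeMagicLabeling k =
      IsEdgeMagic k ×
      (∀ x → (∃[ u ] vertexLabel u ≡ x) ⇔ (1 ≤ x × x ≤ p))

  HasSuperEdgeMagicValence : ℕ → Set
  HasSuperEdgeMagicValence k = Σ[ f ∈ Labeling ] IsSuperEdgeMagicLabeling f k

  IsSuperEdgeMagic : Set
  IsSuperEdgeMagic = ∃ HasSuperEdgeMagicValence

  module _ .{{_ : NonZero q}} where

    -- The second sum is that of the integers p+1, …, p+q.
    magicMean : (Fin p ⤖ Interval 1 p) → ℚ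
    magicMean g =
      + (sum (λ u → deg u * proj₁ (Bijection.to g u)) +
         sum {q} (λ i → suc p + toℕ i)) / q

    S : Pred ℚ 0ℓ
    S s = ∃[ g ] s ≡ magicMean g

    -- Empty when ⌈min S⌉ > ⌊max S⌋.
    I : Pred ℤ 0ℓ
    I k = ∃[ m ] ∃[ M ] (IsMin S m × IsMax S M × ceiling m ℤ.≤ k × k ℤ.≤ floor M)

    σ : Pred ℤ 0ℓ
    σ k = I k × (∃[ n ] (k ≡ + n × HasSuperEdgeMagicValence n))

-- Let k be the valence of a super edge-magic labeling.  The labels of the edges
-- are exactly p+1, …, p+q.  The ends of the edge labelled p+1 have distinct
-- labels in [1,p], with sum at most 2p−1, so k ≤ 3p; the ends of the edge
-- labelled p+q = 3p−3 have sum at least 3, so k ≥ 3p.  Summing the magic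
-- condition over all edges exhibits k as an element of S, so that k lies
-- between ⌈min S⌉ and ⌊max S⌋.

module Submission where

open import Defs
open import Data.Bool.Base using (true; false; if_then_else_)
open import Data.Fin.Base as Fin using (Fin; zero; suc; toℕ; fromℕ<)
open import Data.Fin.Permutation
  using (Permutation; Permutation′; _≈_; id; insert; remove; insert-remove; _⟨$⟩ʳ_)
import Data.Fin.Properties as Fin
open import Data.Integer.Base as ℤ using (+_; _-_; +[1+_]; -[1+_]; +0)
import Data.Integer.DivMod as ℤ
import Data.Integer.Properties as ℤ
import Data.List.Base as List
import Data.List.Extrema as Extrema
open import Data.List.Membership.Propositional.Properties using (∈-allFin)
import Data.List.Relation.Unary.All as All
open import Data.Nat.Base
  using (ℕ; zero; suc; _+_; _*_; _∸_; _≤_; _≰_; _<_; NonZero; >-nonZero⁻¹; z≤n; s≤s)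
open import Data.Nat.Properties
open import Data.Product.Base using (∃-syntax; _×_; _,_; proj₁; proj₂)
open import Data.Rational.Base as ℚ using (ℚ; mkℚ; _/_; floor; ceiling)
open import Data.Rational.Literals using (fromℤ)
import Data.Rational.Properties as ℚ
open import Data.Rational.Unnormalised.Base using (mkℚᵘ; *≡*)
open import Data.Sum.Base using (inj₁; inj₂)
open import Data.Sum.Properties using (inj₁-injective; inj₂-injective)
open import Data.Vec.Base using (count; tabulate)
open import Function.Base using (_∘_; case_of_)
open import Function.Bundles
  using (_⤖_; _↔_; mk⤖; mk↔ₛ′; mk⇔; module Bijection; module Inverse; module Equivalence)
open import Function.Construct.Composition using (_↔-∘_)
open import Function.Construct.Symmetry using (↔-sym)
open import Function.Definitions using (Injective)
open import Function.Properties.Bijection using (⤖⇒↔)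
open import Function.Properties.Inverse using (↔⇒⤖)
open import Level using (0ℓ)
open import Relation.Binary.Bundles using (TotalOrder)
import Relation.Binary.Construct.Flip.EqAndOrd as Flip
open import Relation.Binary.Definitions using (tri<; tri≈; tri>)
open import Relation.Binary.PropositionalEquality
  using (_≡_; _≢_; refl; sym; trans; cong; cong₂; subst; module ≡-Reasoning)
open import Relation.Binary.Structures using (IsTotalOrder)
open import Relation.Nullary.Decidable using (does; yes; no)
open import Relation.Nullary.Negation using (contradiction)
open import Relation.Unary using (Pred; Decidable)

open import Algebra.Properties.Semiring.Sum +-*-semiring
  using (sum; sum-cong-≗; sum-replicate-zero; ∑-distrib-+; ∑-comm; sum-permute)

-- Integer intervals and sums of two distinct labels.

Interval-≡ : ∀ {a b} {x y : Interval a b} → proj₁ x ≡ proj₁ y → x ≡ y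
Interval-≡ {x = x , l , u} {y = .x , l′ , u′} refl =
  cong (x ,_) (cong₂ _,_ (≤-irrelevant l l′) (≤-irrelevant u u′))

-- Used with a = 0 for vertex labels and a = p for edge labels. The successor form makes the image
-- of `i` agree definitionally with the summand `suc p + toℕ i` of `magicMean`.
Fin↔Interval : ∀ a n → Fin n ↔ Interval (suc a) (a + n)
Fin↔Interval a n = mk↔ₛ′ to from to∘from from∘to
  where
  to : Fin n → Interval (suc a) (a + n)
  to i = suc (a + toℕ i) , s≤s (m≤m+n a (toℕ i)) ,
         subst (_≤ a + n) (+-suc a (toℕ i)) (+-monoʳ-≤ a (Fin.toℕ<n i))

  x∸1+a<n : ∀ {x} → suc a ≤ x → x ≤ a + n → x ∸ suc a < n
  x∸1+a<n {x} a<x x≤a+n = +-cancelˡ-< a _ _ (begin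
    suc (a + (x ∸ suc a)) ≡⟨ m+[n∸m]≡n a<x ⟩
    x                     ≤⟨ x≤a+n ⟩
    a + n                 ∎)
    where open ≤-Reasoning

  from : Interval (suc a) (a + n) → Fin n
  from (x , a<x , x≤a+n) = fromℕ< (x∸1+a<n a<x x≤a+n)

  to∘from : ∀ x → to (from x) ≡ x
  to∘from (x , a<x , x≤a+n) = Interval-≡ (begin
    suc a + toℕ (fromℕ< (x∸1+a<n a<x x≤a+n)) ≡⟨ cong (λ t → suc a + t) (Fin.toℕ-fromℕ< _) ⟩
    suc a + (x ∸ suc a)                       ≡⟨ m+[n∸m]≡n a<x ⟩
    x                                         ∎)
    where open ≡-Reasoning

  from∘to : ∀ i → from (to i) ≡ i
  from∘to i = Fin.toℕ-injective (trans (Fin.toℕ-fromℕ< _) (m+n∸m≡n a (toℕ i)))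

-- The smaller of two distinct numbers bounded by p is strictly below p.
a+b<p+p : ∀ {a b p} → a ≢ b → a ≤ p → b ≤ p → a + b < p + p
a+b<p+p {a} {b} a≢b a≤p b≤p with <-cmp a b
... | tri< a<b _ _ = +-mono-<-≤ (<-≤-trans a<b b≤p) b≤p
... | tri≈ _ a≡b _ = contradiction a≡b a≢b
... | tri> _ _ b<a = +-mono-≤-< a≤p (<-≤-trans b<a a≤p)

3≤a+b : ∀ {a b} → a ≢ b → 1 ≤ a → 1 ≤ b → 3 ≤ a + b
3≤a+b {a} {b} a≢b 1≤a 1≤b with <-cmp a b
... | tri< a<b _ _ = +-mono-≤ 1≤a (≤-<-trans 1≤a a<b)
... | tri≈ _ a≡b _ = contradiction a≡b a≢b
... | tri> _ _ b<a = +-mono-≤ (≤-<-trans 1≤b b<a) 1≤b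

-- Floors, ceilings and integral fractions.

≤⇒≤floor : ∀ i s → fromℤ i ℚ.≤ s → i ℤ.≤ floor s
≤⇒≤floor i (mkℚ n d _) (ℚ.*≤* i*d≤n*1) = begin
  i                              ≤⟨ ℤ.i<j⇒i≤pred[j] i<1+⌊s⌋ ⟩
  ℤ.pred (ℤ.suc (n ℤ./ℕ suc d))  ≡⟨ ℤ.pred-suc (n ℤ./ℕ suc d) ⟩
  n ℤ./ℕ suc d                   ≡⟨ ℤ.div-pos-is-/ℕ n (suc d) ⟨
  n ℤ./ + suc d                  ∎
  where
  open ℤ.≤-Reasoning

  i<1+⌊s⌋ : i ℤ.< ℤ.suc (n ℤ./ℕ suc d)
  -- The comparison is made after multiplying by the denominator, where division with remainder
  -- gives n < (⌊s⌋ + 1)(d + 1). An integer below ⌊s⌋ + 1 is at most ⌊s⌋.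
  i<1+⌊s⌋ = ℤ.*-cancelʳ-<-nonNeg (+ suc d) (begin-strict
    i ℤ.* + suc d                     ≤⟨ i*d≤n*1 ⟩
    n ℤ.* + 1                         ≡⟨ ℤ.*-identityʳ n ⟩
    n                                 <⟨ ℤ.n<s[n/ℕd]*d n (suc d) ⟩
    ℤ.suc (n ℤ./ℕ suc d) ℤ.* + suc d  ∎)

neg-fromℤ : ∀ i → ℚ.- fromℤ i ≡ fromℤ (ℤ.- i)
neg-fromℤ +0       = refl
neg-fromℤ +[1+ n ] = refl
neg-fromℤ -[1+ n ] = refl

-- Negation exchanges floor and ceiling: once `s` is matched as a record, its ceiling unfolds to
-- minus the floor of `- s`.
≤⇒ceiling≤ : ∀ i s → s ℚ.≤ fromℤ i → ceiling s ℤ.≤ i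
≤⇒ceiling≤ i s@record{} s≤i = subst (ℤ.- floor (ℚ.- s) ℤ.≤_) (ℤ.neg-involutive i)
  (ℤ.neg-mono-≤ (≤⇒≤floor (ℤ.- i) (ℚ.- s)
    (subst (ℚ._≤ ℚ.- s) (neg-fromℤ i) (ℚ.neg-antimono-≤ s≤i))))

-- Since `_/_` reduces to lowest terms, the fractions n/q and k/1 are compared by
-- cross-multiplication in unnormalised form.
/≡fromℤ : ∀ {n k} q .{{_ : NonZero q}} → n ≡ k * q → + n / q ≡ fromℤ (+ k)
/≡fromℤ {n} {k} q@(suc d) n≡k*q = trans
  (ℚ.fromℚᵘ-cong {mkℚᵘ (+ n) d} {mkℚᵘ (+ k) 0} (*≡* (begin
    + n ℤ.* + 1  ≡⟨ ℤ.*-identityʳ (+ n) ⟩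
    + n          ≡⟨ cong +_ n≡k*q ⟩
    + (k * q)    ≡⟨ ℤ.pos-* k q ⟩
    + k ℤ.* + q  ∎)))
  (ℚ.fromℚᵘ-toℚᵘ (fromℤ (+ k)))
  where open ≡-Reasoning

-- Sums over finite index sets and counting.

sum-const : ∀ n k → sum {n} (λ _ → k) ≡ k * n
sum-const zero    k = sym (*-zeroʳ k)
sum-const (suc n) k = trans (cong (λ t → k + t) (sum-const n k)) (sym (*-suc k n))

-- Turns a weighted degree into a sum of indicator terms over edges. The general `h` lets the
-- induction pass to the tail, where `h` becomes `h ∘ suc`.
count-tabulate-* : ∀ {A : Set} {P : Pred A 0ℓ} (P? : Decidable P) {n} (h : Fin n → A) x →
  count P? (tabulate h) * x ≡ sum (λ i → if does (P? (h i)) then x else 0)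
count-tabulate-* P? {zero}  h x = refl
count-tabulate-* P? {suc n} h x with does (P? (h zero))
... | true  = cong (_+_ x) (count-tabulate-* P? (h ∘ suc) x)
... | false = count-tabulate-* P? (h ∘ suc) x

sum-single : ∀ {n} (a : Fin n) (w : Fin n → ℕ) →
  sum (λ u → if does (a Fin.≟ u) then w u else 0) ≡ w a
sum-single {suc n} zero    w =
  trans (cong (λ t → w zero + t) (sum-replicate-zero n)) (+-identityʳ (w zero))
sum-single {suc n} (suc a) w = sum-single a (w ∘ suc)

-- Extremal values over all permutations.

insert-cong : ∀ {m n} i j (π ρ : Permutation m n) → π ≈ ρ → insert i j π ≈ insert i j ρ
insert-cong i j π ρ π≈ρ k with i Fin.≟ k
... | yes _   = refl
... | no  i≢k = cong (Fin.punchIn j) (π≈ρ (Fin.punchOut i≢k))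

module _ {c ℓ₁ ℓ₂} (O : TotalOrder c ℓ₁ ℓ₂) where
  open TotalOrder O using (Carrier) renaming (_≤_ to _≼_; trans to ≼-trans)

  least-value : ∀ {n} (v : Fin (suc n) → Carrier) → ∃[ j ] ∀ i → v j ≼ v i
  least-value {n} v = Extrema.argmin O v zero is ,
    λ i → All.lookup (Extrema.f[argmin]≤f[xs] O {f = v} zero is) (∈-allFin i)
    where is = List.allFin (suc n)

  -- Every `ρ` is recovered, up to pointwise equality, by inserting the image of zero into the
  -- permutation left after removing zero. Hence the least among the minima for each image of zero
  -- is least overall.
  least-of-leasts : ∀ {n} (F : Permutation′ (suc n) → Carrier) →
    (∀ π ρ → π ≈ ρ → F π ≼ F ρ) →
    (π : Fin (suc n) → Permutation′ n) →
    (∀ i ρ → F (insert zero i (π i)) ≼ F (insert zero i ρ)) →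
    ∀ j → (∀ i → F (insert zero j (π j)) ≼ F (insert zero i (π i))) →
    ∀ ρ → F (insert zero j (π j)) ≼ F ρ
  least-of-leasts F F-resp π π-least j j-least ρ =
    let i  = ρ ⟨$⟩ʳ zero
        ρ′ = remove zero ρ
    in ≼-trans (j-least i)
         (≼-trans (π-least i ρ′) (F-resp (insert zero i ρ′) ρ (insert-remove zero ρ)))

  -- Induction on n, splitting permutations by the image of zero. `F` has to respect `≈` because
  -- removal followed by insertion restores a permutation only pointwise.
  least-permutation : ∀ n (F : Permutation′ n → Carrier) →
    (∀ π ρ → π ≈ ρ → F π ≼ F ρ) → ∃[ π ] ∀ ρ → F π ≼ F ρ
  least-permutation zero    F F-resp = id , λ ρ → F-resp id ρ λ ()
  least-permutation (suc n) F F-resp =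
    let least-sending-0-to i = least-permutation n (F ∘ insert zero i)
          λ π ρ π≈ρ → F-resp (insert zero i π) (insert zero i ρ) (insert-cong zero i π ρ π≈ρ)
        π i = proj₁ (least-sending-0-to i)
        j , j-least = least-value λ i → F (insert zero i (π i))
    in insert zero j (π j) ,
       least-of-leasts F F-resp π (λ i → proj₂ (least-sending-0-to i)) j j-least

-- Degree sums and the extrema of S.

module _ {p q : ℕ} (G : Graph p q) where
  open Graph G

  src≢tgt : ∀ e → src e ≢ tgt e
  src≢tgt e src≡tgt = <⇒≢ (ends-ordered e) (cong toℕ src≡tgt)

  -- Double counting of incidences: the sum over vertices and edges is exchanged, and each edge then
  -- contributes the weights of its two ends.
  handshake : ∀ (w : Fin p → ℕ) → sum (λ u → deg u * w u) ≡ sum (λ e → w (src e) + w (tgt e))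
  handshake w = begin
    sum (λ u → deg u * w u)
      ≡⟨ sum-cong-≗ (λ u → count-tabulate-* (incident? u) (λ e → e) (w u)) ⟩
    sum (λ u → sum (λ e → if does (incident? u e) then w u else 0))
      ≡⟨ ∑-comm (λ u e → if does (incident? u e) then w u else 0) ⟩
    sum (λ e → sum (λ u → if does (incident? u e) then w u else 0))
      ≡⟨ sum-cong-≗ (λ e → trans (sum-cong-≗ (split e)) (∑-distrib-+ (at (src e)) (at (tgt e)))) ⟩
    sum (λ e → sum (at (src e)) + sum (at (tgt e)))
      ≡⟨ sum-cong-≗ (λ e → cong₂ _+_ (sum-single (src e) w) (sum-single (tgt e) w)) ⟩
    sum (λ e → w (src e) + w (tgt e)) ∎
    where
    open ≡-Reasoning

    at : Fin p → Fin p → ℕ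
    at a u = if does (a Fin.≟ u) then w u else 0

    split : ∀ e u → (if does (incident? u e) then w u else 0) ≡ at (src e) u + at (tgt e) u
    split e u with src e Fin.≟ u | tgt e Fin.≟ u
    -- There are no loops, so the indicator of incidence is the sum of the indicators of the two
    -- ends.
    ... | yes s≡u | yes t≡u = contradiction (trans s≡u (sym t≡u)) (src≢tgt e)
    ... | yes _   | no _    = sym (+-identityʳ (w u))
    ... | no _    | yes _   = refl
    ... | no _    | no _    = refl

  module _ .{{_ : NonZero q}} where

    magicMean-cong : ∀ g h → (∀ u → proj₁ (Bijection.to g u) ≡ proj₁ (Bijection.to h u)) →
      magicMean G g ≡ magicMean G h
    magicMean-cong g h g≗h = cong (λ t → + (t + sum {q} (λ i → suc p + toℕ i)) / q)
      (sum-cong-≗ (λ u → cong (deg u *_) (g≗h u)))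

    -- The order is a parameter so that its reversal yields the maximum. Bijections onto [1,p] are
    -- transported to permutations of `Fin p`, over which a least value has been found.
    S-least : (_≼_ : ℚ → ℚ → Set) → IsTotalOrder _≡_ _≼_ →
      ∃[ m ] (S G m × ∀ s → S G s → m ≼ s)
    S-least _≼_ isTO = magicMean G (bij π) , (bij π , refl) , λ where
        s (g , refl) → subst (magicMean G (bij π) ≼_)
          (magicMean-cong (bij (perm g)) g (bij∘perm g)) (π-least (perm g))
      where
      O : TotalOrder 0ℓ 0ℓ 0ℓ
      O = record { isTotalOrder = isTO }

      bij : Permutation′ p → Fin p ⤖ Interval 1 p
      bij π = ↔⇒⤖ (Fin↔Interval 0 p ↔-∘ π)

      perm : Fin p ⤖ Interval 1 p → Permutation′ p
      perm g = ↔-sym (Fin↔Interval 0 p) ↔-∘ ⤖⇒↔ g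

      bij∘perm : ∀ g u → proj₁ (Bijection.to (bij (perm g)) u) ≡ proj₁ (Bijection.to g u)
      bij∘perm g u =
        cong proj₁ (Inverse.strictlyInverseˡ (Fin↔Interval 0 p) (Bijection.to g u))

      minimum : ∃[ π ] ∀ ρ → magicMean G (bij π) ≼ magicMean G (bij ρ)
      minimum = least-permutation O p (magicMean G ∘ bij) λ π ρ π≈ρ →
        TotalOrder.reflexive O (magicMean-cong (bij π) (bij ρ) (λ u → cong (suc ∘ toℕ) (π≈ρ u)))

      π = proj₁ minimum
      π-least = proj₂ minimum

    -- An integer above min S is at least its ceiling, and an integer below max S is at most its
    -- floor.
    S-member⇒I-between : ∀ m M → IsMin (S G) m → IsMax (S G) M →
      ∀ {k} → S G (fromℤ k) → I G k
    S-member⇒I-between m M m-min M-max {k} k∈S =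
      m , M , m-min , M-max ,
      ≤⇒ceiling≤ k m (proj₂ m-min _ k∈S) , ≤⇒≤floor k M (proj₂ M-max _ k∈S)

    S-min : ∃[ m ] IsMin (S G) m
    S-min = S-least ℚ._≤_ ℚ.≤-isTotalOrder

    S-max : ∃[ M ] IsMax (S G) M
    S-max = S-least ℚ._≥_ (Flip.isTotalOrder ℚ.≤-isTotalOrder)

    S-member⇒I : ∀ {k} → S G (fromℤ k) → I G k
    S-member⇒I = S-member⇒I-between (proj₁ S-min) (proj₁ S-max) (proj₂ S-min) (proj₂ S-max)

  -- Labels and valence of a super edge-magic labeling.

  module _ (f : Labeling G) (k : ℕ) (f-sem : IsSuperEdgeMagicLabeling G f k) where
    private
      vl = vertexLabel G f
      el = edgeLabel G f
      magic = proj₁ f-sem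
      range = proj₂ f-sem
      module f = Bijection f

    vl-bounds : ∀ u → 1 ≤ vl u × vl u ≤ p
    vl-bounds u = Equivalence.to (range (vl u)) (u , refl)

    vl-injective : Injective _≡_ _≡_ vl
    vl-injective = inj₁-injective ∘ f.injective ∘ Interval-≡

    vertexBijection : Fin p ⤖ Interval 1 p
    vertexBijection = mk⤖ {to = λ u → vl u , vl-bounds u}
      ( vl-injective ∘ cong proj₁
      , λ (x , x-bounds) → let u , vl-u = Equivalence.from (range x) x-bounds in
          u , λ { refl → Interval-≡ vl-u })

    -- The vertex labels already exhaust [1,p], so by injectivity of `f` no edge label lies there.
    el-bounds : ∀ e → suc p ≤ el e × el e ≤ p + q
    el-bounds e = ≰⇒> el≰p , proj₂ (proj₂ (f.to (inj₂ e)))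
      where
      el≰p : el e ≰ p
      el≰p el≤p with Equivalence.from (range (el e)) (proj₁ (proj₂ (f.to (inj₂ e))) , el≤p)
      ... | u , vl≡el = case f.injective {inj₁ u} {inj₂ e} (Interval-≡ vl≡el) of λ ()

    el-surjective : ∀ x → suc p ≤ x → x ≤ p + q → ∃[ e ] el e ≡ x
    el-surjective x p<x x≤p+q with f.strictlySurjective (x , ≤-trans (s≤s z≤n) p<x , x≤p+q)
    ... | inj₁ u , f-u =
      contradiction (subst (_≤ p) (cong proj₁ f-u) (proj₂ (vl-bounds u))) (<⇒≱ p<x)
    ... | inj₂ e , f-e = e , cong proj₁ f-e

    edgeBijection : Fin q ⤖ Interval (suc p) (p + q)
    edgeBijection = mk⤖ {to = λ e → el e , el-bounds e}
      ( inj₂-injective ∘ f.injective ∘ Interval-≡ ∘ cong proj₁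
      , λ (x , p<x , x≤p+q) → let e , el-e = el-surjective x p<x x≤p+q in
          e , λ { refl → Interval-≡ el-e })

    -- The edge labels rearrange p+1, ..., p+q, and a sum is invariant under permutation of its
    -- indices.
    sum-el : sum el ≡ sum {q} (λ i → suc p + toℕ i)
    sum-el = sym (trans (sum-permute (λ i → suc p + toℕ i) π)
      (sum-cong-≗ λ e → cong proj₁
        (Inverse.strictlyInverseˡ (Fin↔Interval p q) (Bijection.to edgeBijection e))))
      where
      π : Permutation′ q
      π = ↔-sym (Fin↔Interval p q) ↔-∘ ⤖⇒↔ edgeBijection

    valence∈S : .{{_ : NonZero q}} → S G (fromℤ (+ k))
    valence∈S = vertexBijection , sym (/≡fromℤ {k = k} q (begin
      sum (λ u → deg u * vl u) + sum {q} (λ i → suc p + toℕ i)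
        ≡⟨ cong₂ _+_ (handshake vl) (sym sum-el) ⟩
      sum (λ e → vl (src e) + vl (tgt e)) + sum el
        ≡⟨ ∑-distrib-+ (λ e → vl (src e) + vl (tgt e)) el ⟨
      sum (λ e → vl (src e) + vl (tgt e) + el e)
        ≡⟨ sum-cong-≗ magic ⟩
      sum {q} (λ _ → k)
        ≡⟨ sum-const q k ⟩
      k * q ∎))
      where open ≡-Reasoning

    end-labels-distinct : ∀ e → vl (src e) ≢ vl (tgt e)
    end-labels-distinct e = src≢tgt e ∘ vl-injective

    valence≡3p : 1 ≤ q → q + 3 ≡ 2 * p → k ≡ 3 * p
    valence≡3p 1≤q q+3≡2p = ≤-antisym k≤3p 3p≤k
      where
      open ≤-Reasoning

      p<p+q : p < p + q
      p<p+q = subst (_≤ p + q) (+-comm p 1) (+-monoʳ-≤ p 1≤q)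

      k≤3p : k ≤ 3 * p
      k≤3p with e , el-e ← el-surjective (suc p) ≤-refl p<p+q = begin
        k                                ≡⟨ magic e ⟨
        vl (src e) + vl (tgt e) + el e   ≡⟨ cong (λ t → vl (src e) + vl (tgt e) + t) el-e ⟩
        vl (src e) + vl (tgt e) + suc p  ≡⟨ +-suc _ p ⟩
        suc (vl (src e) + vl (tgt e)) + p
          -- The strict bound 2p on the sum of the end labels absorbs the successor coming from the
          -- edge label p+1.
          ≤⟨ +-monoˡ-≤ p (a+b<p+p (end-labels-distinct e)
               (proj₂ (vl-bounds (src e))) (proj₂ (vl-bounds (tgt e)))) ⟩
        p + p + p                        ≡⟨ +-assoc p p p ⟩
        p + (p + p)                      ≡⟨ cong (λ t → p + (p + t)) (+-identityʳ p) ⟨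
        3 * p                            ∎

      3p≤k : 3 * p ≤ k
      3p≤k with e , el-e ← el-surjective (p + q) p<p+q ≤-refl = begin
        -- The size condition replaces 2p by q+3, where 3 = 1+2 is the least sum of two distinct
        -- positive labels.
        p + 2 * p                        ≡⟨ cong (λ t → p + t) q+3≡2p ⟨
        p + (q + 3)                      ≡⟨ +-assoc p q 3 ⟨
        p + q + 3                        ≡⟨ +-comm (p + q) 3 ⟩
        3 + (p + q)
          ≤⟨ +-monoˡ-≤ (p + q) (3≤a+b (end-labels-distinct e)
               (proj₁ (vl-bounds (src e))) (proj₁ (vl-bounds (tgt e)))) ⟩
        vl (src e) + vl (tgt e) + (p + q) ≡⟨ cong (λ t → vl (src e) + vl (tgt e) + t) el-e ⟨
        vl (src e) + vl (tgt e) + el e   ≡⟨ magic e ⟩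
        k                                ∎

-- Cardinality of the super edge-magic set.

theorem2p1 : ∀ {p q : ℕ} .{{_ : NonZero q}} (G : Graph p q) →
    IsSuperEdgeMagic G →
    + q ≡ + (2 * p) - + 3 →
    HasGirth G 3 →
    HasCardinality (σ G) 1
theorem2p1 {p} {q} G (k , f , f-sem) q≡2p-3 _ =
  -- The valence k of the given labeling is the only element: any valence in the set equals 3p, as
  -- does k.
  (λ _ → + k) , (λ { {zero} {zero} _ → refl }) , λ i → mk⇔
    (λ { (_ , n , refl , f′ , f′-sem) →
      zero , cong +_ (trans (valence f f-sem) (sym (valence f′ f′-sem))) })
    (λ { (_ , refl) → S-member⇒I G (valence∈S G f k f-sem) , k , refl , f , f-sem })
  where
  -- Adding 3 over the integers brings the size condition back to natural numbers without truncated
  -- subtraction.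
  q+3≡2p : q + 3 ≡ 2 * p
  q+3≡2p = ℤ.+-injective (begin
    + (q + 3)                    ≡⟨ ℤ.pos-+ q 3 ⟩
    + q ℤ.+ + 3                  ≡⟨ cong (ℤ._+ + 3) q≡2p-3 ⟩
    + (2 * p) - + 3 ℤ.+ + 3      ≡⟨ ℤ.+-assoc (+ (2 * p)) (ℤ.- + 3) (+ 3) ⟩
    + (2 * p) ℤ.+ + 0            ≡⟨ ℤ.+-identityʳ (+ (2 * p)) ⟩
    + (2 * p)                    ∎)
    where open ≡-Reasoning

  valence : ∀ {n} f → IsSuperEdgeMagicLabeling G f n → n ≡ 3 * p
  valence f f-sem = valence≡3p G f _ f-sem (>-nonZero⁻¹ q) q+3≡2p
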